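{- For every integer $n>1$, the number of maximal transitive partitions of the set of edges of the transitive tournament $\overrightarrow{K}_n$ is equal to the Catalan number $C_{n-1}:=\frac{1}{n}\binom{2n-2}{n-1}$.
   Context: The transitive tournament $\overrightarrow{K}_n$ is the directed graph with vertex set $\{1,\dots,n\}$ and directed edges $(i,j)$, $1\le i<j\le n$. A transitive $k$-partition of $\overrightarrow{K}_n$ is a (unordered) partition of its edge set into $k$ nonempty blocks such that every cycle of the underlying undirected graph contains two edges belonging to the same block that have opposite orientations with respect to a traversal of the cycle. (Equivalently, for all $i<j<m$ the edge $(i,m)$ lies in the same block as $(i,j)$ or in the same block as $(j,m)$.) The maximal possible number of blocks is $n-1$; a transitive partition is maximal if it has exactly $n-1$ blocks. -}

module Defs where

open import Data.Fin.Base using (Fin; _<_)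
open import Data.List.Base using (List; []; _∷_; length)
open import Data.List.Membership.Propositional using (_∈_)
open import Data.List.Relation.Unary.Unique.Propositional using (Unique)
open import Data.Nat.Base using (ℕ; zero; suc; _+_; _*_; _∸_; _≤_; _/_)
open import Data.Nat.Combinatorics using (_C_; nCk+nC[k+1]≡[n+1]C[k+1]; nC1≡n)
open import Data.Nat.Divisibility using (divides; ∣m+n∣m⇒∣n; m∣m*n)
open import Data.Nat.DivMod using (m/n*n≡m)
open import Data.Nat.Properties using (+-cancelʳ-≡; *-comm; *-identityʳ; +-identityʳ)
open import Data.Nat.Solver using (module +-*-Solver)
open import Data.Product.Base using (_×_; ∃-syntax)
open import Function.Base using (id)
open import Function.Bundles using (_⇔_; mk⇔; Bijection; Equivalence)
open import Function.Definitions using (Surjective)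
open import Level using (0ℓ)
open import Relation.Binary.Bundles using (Setoid)
open import Relation.Binary.Construct.Closure.ReflexiveTransitive using (Star; ε; _◅_)
open import Relation.Binary.Construct.Closure.Symmetric using (SymClosure; fwd; bwd)
open import Relation.Binary.PropositionalEquality
  using (_≡_; refl; cong; cong₂; setoid; module ≡-Reasoning)

-- The vertices 1, …, n are represented by Fin n with its usual order. The
-- field src<tgt is irrelevant, so an edge is determined by its endpoints.
record Edge (n : ℕ) : Set where
  constructor edge
  field
    src tgt  : Fin n
    .src<tgt : src < tgt

-- A step u → v of the underlying undirected graph is either fwd (it follows
-- the directed edge (u , v)) or bwd (it runs against the directed edge (v , u)).
Walk : ∀ {n} → Fin n → Fin n → Set
Walk = Star (SymClosure _<_)

-- Every vertex of the walk except the final one, so that on a closed walk the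
-- base point is listed once.
vertices : ∀ {n} {u v : Fin n} → Walk u v → List (Fin n)
vertices ε             = []
vertices (_◅_ {u} _ w) = u ∷ vertices w

forwardEdges : ∀ {n} {u v : Fin n} → Walk u v → List (Edge n)
forwardEdges ε                       = []
forwardEdges (_◅_ {u} {v} (fwd p) w) = edge u v p ∷ forwardEdges w
forwardEdges (bwd _ ◅ w)             = forwardEdges w

backwardEdges : ∀ {n} {u v : Fin n} → Walk u v → List (Edge n)
backwardEdges ε                       = []
backwardEdges (fwd _ ◅ w)             = backwardEdges w
backwardEdges (_◅_ {u} {v} (bwd p) w) = edge v u p ∷ backwardEdges w

IsCycle : ∀ {n} {u : Fin n} → Walk u u → Set
IsCycle w = 3 ≤ length (vertices w) × Unique (vertices w)

-- A partition into k nonempty blocks is given by a surjective labelling of the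
-- edges by Fin k; the names of the labels are forgotten by _≈_ below.
record TransitivePartition (n k : ℕ) : Set where
  field
    block      : Edge n → Fin k
    nonempty   : Surjective _≡_ _≡_ block
    transitive : ∀ {u : Fin n} (w : Walk u u) → IsCycle w →
                 ∃[ e ] ∃[ f ] e ∈ forwardEdges w × f ∈ backwardEdges w
                             × block e ≡ block f

open TransitivePartition public

-- Two labellings are the same unordered partition when they put the same pairs
-- of edges into a common block.
_≈_ : ∀ {n k} → TransitivePartition n k → TransitivePartition n k → Set
P ≈ Q = ∀ e f → (block P e ≡ block P f) ⇔ (block Q e ≡ block Q f)

transitivePartitions : ℕ → ℕ → Setoid 0ℓ 0ℓ
transitivePartitions n k = record
  { Carrier       = TransitivePartition n k
  ; _≈_           = _≈_
  ; isEquivalence = record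
    { refl  = λ _ _ → mk⇔ id id
    ; sym   = λ P≈Q e f → mk⇔ (Equivalence.from (P≈Q e f)) (Equivalence.to (P≈Q e f))
    ; trans = λ P≈Q Q≈R e f → mk⇔
        (λ p → Equivalence.to (Q≈R e f) (Equivalence.to (P≈Q e f) p))
        (λ r → Equivalence.from (P≈Q e f) (Equivalence.from (Q≈R e f) r))
    }
  }

maximalTransitivePartitions : ℕ → Setoid 0ℓ 0ℓ
maximalTransitivePartitions n = transitivePartitions n (n ∸ 1)

HasCardinality : Setoid 0ℓ 0ℓ → ℕ → Set
HasCardinality S N = Bijection S (setoid (Fin N))

catalan : ℕ → ℕ
catalan m = ((2 * m) C m) / suc m

private
  absorption : ∀ n k → suc k * (n C suc k) + k * (n C k) ≡ n * (n C k)
  absorption zero    zero    = refl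
  absorption zero    (suc k) = cong₂ _+_ (*-comm k 0) (*-comm k 0)
  absorption (suc n) zero    = begin
    1 * (suc n C 1) + 0  ≡⟨ +-identityʳ _ ⟩
    1 * (suc n C 1)      ≡⟨ +-identityʳ _ ⟩
    suc n C 1            ≡⟨ nC1≡n (suc n) ⟩
    suc n                ≡⟨ *-identityʳ (suc n) ⟨
    suc n * 1            ∎
    where open ≡-Reasoning
  absorption (suc n) (suc k) = begin
    (2 + k) * (suc n C (2 + k)) + (1 + k) * (suc n C (1 + k))
      ≡⟨ cong₂ (λ x y → (2 + k) * x + (1 + k) * y)
           (nCk+nC[k+1]≡[n+1]C[k+1] n (1 + k)) (nCk+nC[k+1]≡[n+1]C[k+1] n k) ⟨
    (2 + k) * (b + c) + (1 + k) * (a + b)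
      ≡⟨ solve 4 (λ k a b c →
           (con 2 :+ k) :* (b :+ c) :+ (con 1 :+ k) :* (a :+ b) :=
           ((con 2 :+ k) :* c :+ (con 1 :+ k) :* b) :+
           ((con 1 :+ k) :* b :+ k :* a) :+ (a :+ b)) refl k a b c ⟩
    ((2 + k) * c + (1 + k) * b) + ((1 + k) * b + k * a) + (a + b)
      ≡⟨ cong₂ (λ x y → x + y + (a + b)) (absorption n (suc k)) (absorption n k) ⟩
    n * b + n * a + (a + b)
      ≡⟨ solve 3 (λ n a b → n :* b :+ n :* a :+ (a :+ b) :=
                            (con 1 :+ n) :* (a :+ b)) refl n a b ⟩
    suc n * (a + b)
      ≡⟨ cong (suc n *_) (nCk+nC[k+1]≡[n+1]C[k+1] n k) ⟩
    suc n * (suc n C suc k) ∎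
    where
    open ≡-Reasoning
    open +-*-Solver
    a = n C k
    b = n C suc k
    c = n C suc (suc k)

-- The division in catalan is exact.
catalan-exact : ∀ m → catalan m * suc m ≡ (2 * m) C m
catalan-exact m = m/n*n≡m (∣m+n∣m⇒∣n (divides b eq) (m∣m*n c))
  where
  open ≡-Reasoning
  open +-*-Solver
  b = (2 * m) C m
  c = (2 * m) C suc m

  eq : suc m * c + b ≡ b * suc m
  eq = +-cancelʳ-≡ (m * b) _ _ (begin
    suc m * c + b + m * b    ≡⟨ solve 3 (λ m b c → (con 1 :+ m) :* c :+ b :+ m :* b :=
                                  ((con 1 :+ m) :* c :+ m :* b) :+ b) refl m b c ⟩
    suc m * c + m * b + b    ≡⟨ cong (_+ b) (absorption (2 * m) m) ⟩
    2 * m * b + b            ≡⟨ solve 2 (λ m b → con 2 :* m :* b :+ b :=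
                                  b :* (con 1 :+ m) :+ m :* b) refl m b ⟩
    b * suc m + m * b        ∎)

{-# OPTIONS --safe #-}

-- Every edge (i , m) shares its block with some consecutive edge (j , j + 1), i ≤ j < m, so in
-- a maximal partition the n − 1 consecutive edges represent the blocks, and the partition is a
-- labelling f of the edges by gaps with f(i , m) ∈ {f(i , j) , f(j , m)}. The gap r = f(1 , n)
-- labels every edge crossing it, and the edges on either side of r are labelled independently:
-- f is the lowest-common-ancestor labelling of a unique binary tree on the n − 1 gaps.
-- Conversely, a closed walk crossing the root gap of such a tree crosses it in both
-- directions, and a walk that does not cross it lies in a subtree. Finally, forests of k
-- binary trees obey the ballot recursion, which yields the Catalan numbers at k = 1.

module Submission where

open import Defs
open import Data.Fin.Base using (Fin; zero; suc; toℕ; fromℕ<; inject₁; punchOut) renaming (_<_ to _<ᶠ_)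
open import Data.Fin.Properties
  using (+↔⊎; toℕ-injective; toℕ≤pred[n]; toℕ-inject₁; toℕ-fromℕ<; fromℕ<-toℕ; fromℕ<-cong;
         fromℕ<-injective; punchOut-injective; injective⇒≤; ≤̄⇒inject₁<)
  renaming (_≟_ to _≟ᶠ_; <⇒≢ to <⇒≢ᶠ)
open import Data.List.Membership.Propositional using (_∈_)
open import Data.List.Relation.Unary.All using ([]; _∷_)
open import Data.List.Relation.Unary.AllPairs using ([]; _∷_)
open import Data.List.Relation.Unary.Any using (here; there)
open import Data.Nat.Base using (ℕ; zero; suc; _+_; _*_; _∸_; _≤_; _<_; z≤n; s≤s; z<s; s≤s⁻¹)
open import Data.Nat.Combinatorics using (_C_; nC1≡n; nCk≡nC[n∸k]; nCk+nC[k+1]≡[n+1]C[k+1])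
open import Data.Nat.Induction using (<-wellFounded; Acc; acc)
open import Data.Nat.Properties
open import Data.Nat.Solver using (module +-*-Solver)
open import Data.Product.Base using (_×_; _,_; ∃-syntax; proj₁; proj₂) renaming (map to ×-map)
open import Data.Sum.Base using (_⊎_; inj₁; inj₂; [_,_]) renaming (map to ⊎-map)
open import Data.Sum.Function.Propositional using (_⊎-↔_)
open import Data.Vec.Base using (Vec; []; _∷_)
open import Data.Vec.Properties using (∷-injective; ∷-injectiveˡ)
open import Function.Base using (_∘_)
open import Function.Bundles using (_↔_; mk↔ₛ′; mk⇔; Equivalence; Injection; Inverse)
open import Function.Definitions using (Injective; StrictlySurjective; Surjective)
open import Function.Properties.Inverse using (↔-trans; ↔-sym; ↔⇒↣)
open import Relation.Binary.Construct.Closure.ReflexiveTransitive using (ε; _◅_)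
open import Relation.Binary.Construct.Closure.Symmetric using (SymClosure; fwd; bwd)
open import Relation.Binary.PropositionalEquality
  using (_≡_; _≢_; refl; sym; trans; cong; cong₂; subst; subst₂; subst-injective; subst-subst-sym;
         module ≡-Reasoning)
open import Relation.Nullary using (yes; no; contradiction)
open import Relation.Nullary.Decidable using (recompute)

-- Counting binary trees

data Tree : Set where
  leaf : Tree
  node : (l r : Tree) → Tree

size : Tree → ℕ
size leaf       = 0
size (node l r) = suc (size l + size r)

-- Forest k m codes, in preorder, the sequences of k trees with m nodes in total.
data Forest : (k m : ℕ) → Set where
  nil  : Forest 0 0
  leaf : ∀ {k m} → Forest k m → Forest (suc k) m
  node : ∀ {k m} → Forest (2 + k) m → Forest (suc k) (suc m)

graft : ∀ {k} → Vec Tree (2 + k) → Vec Tree (suc k)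
graft (l ∷ r ∷ ts) = node l r ∷ ts

decode : ∀ {k m} → Forest k m → Vec Tree k
decode nil      = []
decode (leaf F) = leaf ∷ decode F
decode (node F) = graft (decode F)

graft-injective : ∀ {k} (ts us : Vec Tree (2 + k)) → graft ts ≡ graft us → ts ≡ us
graft-injective (_ ∷ _ ∷ _) (_ ∷ _ ∷ _) refl = refl

graft≢leaf : ∀ {k} (ts : Vec Tree (2 + k)) {us} → graft ts ≢ leaf ∷ us
graft≢leaf (_ ∷ _ ∷ _) ()

decode-injective : ∀ {k m} {F G : Forest k m} → decode F ≡ decode G → F ≡ G
decode-injective {F = nil}    {nil}    eq = refl
decode-injective {F = leaf F} {leaf G} eq = cong leaf (decode-injective (proj₂ (∷-injective eq)))
decode-injective {F = leaf F} {node G} eq = contradiction (sym eq) (graft≢leaf (decode G))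
decode-injective {F = node F} {leaf G} eq = contradiction eq (graft≢leaf (decode F))
decode-injective {F = node F} {node G} eq = cong node (decode-injective (graft-injective _ _ eq))

totalSize : ∀ {k} → Vec Tree k → ℕ
totalSize []       = 0
totalSize (t ∷ ts) = size t + totalSize ts

totalSize-graft : ∀ {k} (ts : Vec Tree (2 + k)) → totalSize (graft ts) ≡ suc (totalSize ts)
totalSize-graft (l ∷ r ∷ ts) = cong suc (+-assoc (size l) (size r) (totalSize ts))

totalSize-decode : ∀ {k m} (F : Forest k m) → totalSize (decode F) ≡ m
totalSize-decode nil      = refl
totalSize-decode (leaf F) = totalSize-decode F
totalSize-decode (node F) = trans (totalSize-graft (decode F)) (cong suc (totalSize-decode F))

-- The coded forest grows at the front, so `r` is coded first, then `l` before it, and the two are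
-- joined by `node`. The free index `m′` with its equation lets sizes be reassociated without
-- transporting forests.
encode : ∀ t {k m m′} → size t + m ≡ m′ → (F : Forest k m) →
         ∃[ G ] decode {suc k} {m′} G ≡ t ∷ decode F
encode leaf       refl F = leaf F , refl
encode (node l r) {m = m} refl F
  with G , eqG ← encode r refl F
  with H , eqH ← encode l (sym (+-assoc (size l) (size r) m)) G
  = node H , cong graft (trans eqH (cong (l ∷_) eqG))

-- Ballot numbers and Catalan numbers

forestCount : (k m : ℕ) → ℕ
forestCount zero    zero    = 1
forestCount zero    (suc m) = 0
forestCount (suc k) zero    = forestCount k zero
forestCount (suc k) (suc m) = forestCount k (suc m) + forestCount (2 + k) m

Forest↔Fin : ∀ k m → Forest k m ↔ Fin (forestCount k m)
Forest↔Fin zero zero = mk↔ₛ′ (λ _ → zero) (λ _ → nil) (λ { zero → refl }) (λ { nil → refl })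
Forest↔Fin zero (suc m) = mk↔ₛ′ (λ ()) (λ ()) (λ ()) (λ ())
Forest↔Fin (suc k) zero = ↔-trans
  (mk↔ₛ′ (λ { (leaf F) → F }) leaf (λ _ → refl) (λ { (leaf _) → refl }))
  (Forest↔Fin k zero)
Forest↔Fin (suc k) (suc m) = ↔-trans
  (mk↔ₛ′ {B = Forest k (suc m) ⊎ Forest (2 + k) m}
    (λ { (leaf F) → inj₁ F ; (node F) → inj₂ F }) [ leaf , node ]
    (λ { (inj₁ _) → refl ; (inj₂ _) → refl }) (λ { (leaf _) → refl ; (node _) → refl }))
  (↔-trans (Forest↔Fin k (suc m) ⊎-↔ Forest↔Fin (2 + k) m)
           (↔-sym +↔⊎))

C-symmetric : ∀ {n} k j → k + j ≡ n → n C k ≡ n C j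
C-symmetric k j refl = trans (nCk≡nC[n∸k] (m≤m+n k j)) (cong ((k + j) C_) (m+n∸m≡n k j))

-- The ballot numbers: both sides of the recursion of forestCount satisfy Pascal's rule.
forestCount-ballot : ∀ k m → forestCount k (suc m) + (suc (k + 2 * m) C m)
                             ≡ suc (k + 2 * m) C suc m
-- Without trees the count is 0, and the claim says that the two middle entries of row 2m + 1 agree.
forestCount-ballot zero m = C-symmetric m (suc m)
  (trans (+-suc m m) (cong (λ x → suc (m + x)) (sym (+-identityʳ m))))
forestCount-ballot (suc k) zero = begin
  forestCount k 1 + forestCount k 0 + 1
    ≡⟨ cong (λ x → forestCount k 1 + x + 1) (forestCount-zero k) ⟩
  forestCount k 1 + 1 + 1
    ≡⟨ cong (_+ 1) (forestCount-ballot k zero) ⟩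
  (suc (k + 0) C 1) + 1
    ≡⟨ +-comm (suc (k + 0) C 1) 1 ⟩
  1 + (suc (k + 0) C 1)
    ≡⟨ nCk+nC[k+1]≡[n+1]C[k+1] (suc (k + 0)) 0 ⟩
  suc (suc (k + 0)) C 1 ∎
  where
  open ≡-Reasoning
  forestCount-zero : ∀ k → forestCount k 0 ≡ 1
  forestCount-zero zero    = refl
  forestCount-zero (suc k) = forestCount-zero k
forestCount-ballot (suc k) (suc m) = begin
  (x + y) + (suc N C suc m)
    ≡⟨ cong ((x + y) +_) (nCk+nC[k+1]≡[n+1]C[k+1] N m) ⟨
  (x + y) + ((N C m) + (N C suc m))
    ≡⟨ solve 4 (λ x y a b → (x :+ y) :+ (a :+ b) := (y :+ a) :+ (x :+ b)) refl
         x y (N C m) (N C suc m) ⟩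
  (y + (N C m)) + (x + (N C suc m))
    -- Trading a node for two more trees keeps k + 2m fixed, so both induction hypotheses concern
    -- row `N`.
    ≡⟨ cong₂ _+_ (subst (λ n → y + (n C m) ≡ n C suc m) (sym N≡)
                    (forestCount-ballot (2 + k) m))
                 (forestCount-ballot k (suc m)) ⟩
  (N C suc m) + (N C (2 + m))
    ≡⟨ nCk+nC[k+1]≡[n+1]C[k+1] N (suc m) ⟩
  suc N C (2 + m) ∎
  where
  open ≡-Reasoning
  open +-*-Solver
  x = forestCount k (2 + m)
  y = forestCount (2 + k) (suc m)
  N = suc (k + 2 * suc m)
  N≡ : N ≡ suc (2 + k + 2 * m)
  N≡ = solve 2 (λ k m → con 1 :+ (k :+ con 2 :* (con 1 :+ m)) :=
                        con 1 :+ (con 2 :+ k :+ con 2 :* m)) refl k m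

C-absorption : ∀ n k → suc k * (suc n C suc k) ≡ suc n * (n C k)
C-absorption zero    zero    = refl
C-absorption zero    (suc k) = *-zeroʳ (2 + k)
C-absorption (suc n) zero    = trans (*-identityˡ _)
  (trans (nC1≡n (2 + n)) (sym (*-identityʳ (2 + n))))
C-absorption (suc n) (suc k) = begin
  (2 + k) * ((2 + n) C (2 + k))
    ≡⟨ cong ((2 + k) *_) (nCk+nC[k+1]≡[n+1]C[k+1] (suc n) (suc k)) ⟨
  (2 + k) * (a + b)
    ≡⟨ solve 3 (λ k a b → (con 2 :+ k) :* (a :+ b) :=
         a :+ ((con 1 :+ k) :* a :+ (con 2 :+ k) :* b)) refl k a b ⟩
  a + ((1 + k) * a + (2 + k) * b)
    ≡⟨ cong (a +_) (cong₂ _+_ (C-absorption n k) (C-absorption n (suc k))) ⟩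
  a + (suc n * (n C k) + suc n * (n C suc k))
    ≡⟨ cong (a +_) (*-distribˡ-+ (suc n) (n C k) (n C suc k)) ⟨
  a + suc n * ((n C k) + (n C suc k))
    ≡⟨ cong (λ x → a + suc n * x) (nCk+nC[k+1]≡[n+1]C[k+1] n k) ⟩
  (2 + n) * a ∎
  where
  open ≡-Reasoning
  open +-*-Solver
  a = suc n C suc k
  b = suc n C (2 + k)

-- For k = 1 the ballot formula gives the count as C(2m+2, m+1) - C(2m+2, m). Multiplying by m + 2
-- and adding the second term to both sides avoids division and subtraction.
forestCount≡catalan : ∀ m → forestCount 1 m ≡ catalan m
forestCount≡catalan zero    = refl
forestCount≡catalan (suc m) = *-cancelʳ-≡ _ _ (2 + m) (+-cancelʳ-≡ ((2 + m) * c) _ _ (begin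
  f * (2 + m) + (2 + m) * c
    ≡⟨ solve 3 (λ f m c → f :* m :+ m :* c := m :* (f :+ c)) refl f (2 + m) c ⟩
  (2 + m) * (f + c)
    ≡⟨ cong ((2 + m) *_) ballot ⟩
  b + (1 + m) * b
    ≡⟨ cong (b +_) [1+m]b≡[2+m]c ⟩
  b + (2 + m) * c
    ≡⟨ cong (_+ (2 + m) * c) (catalan-exact (suc m)) ⟨
  catalan (suc m) * (2 + m) + (2 + m) * c ∎))
  where
  open ≡-Reasoning
  open +-*-Solver
  f = forestCount 1 (suc m)
  b = (2 * suc m) C suc m
  c = (2 * suc m) C m
  M = suc (2 * m)

  2[1+m] : 2 * suc m ≡ suc M
  2[1+m] = solve 1 (λ m → con 2 :* (con 1 :+ m) := con 2 :+ con 2 :* m) refl m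

  ballot : f + c ≡ b
  ballot = subst (λ n → f + (n C m) ≡ n C suc m) (sym 2[1+m]) (forestCount-ballot 1 m)

  -- By absorption each side is 2m + 2 times one of the two equal middle entries of row 2m + 1.
  [1+m]b≡[2+m]c : (1 + m) * b ≡ (2 + m) * c
  [1+m]b≡[2+m]c = begin
    (1 + m) * b                   ≡⟨ cong (λ n → (1 + m) * (n C suc m)) 2[1+m] ⟩
    (1 + m) * (suc M C suc m)     ≡⟨ C-absorption M m ⟩
    suc M * (M C m)               ≡⟨ cong (suc M *_) (C-symmetric m (suc m)
      (solve 1 (λ m → m :+ (con 1 :+ m) := con 1 :+ con 2 :* m) refl m)) ⟩
    suc M * (M C suc m)           ≡⟨ C-absorption M (suc m) ⟨
    (2 + m) * (suc M C (2 + m))   ≡⟨ cong (λ n → (2 + m) * (n C (2 + m))) 2[1+m] ⟨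
    (2 + m) * ((2 * suc m) C (2 + m)) ≡⟨ cong ((2 + m) *_) (C-symmetric (2 + m) m
      (solve 1 (λ m → con 2 :+ m :+ m := con 2 :* (con 1 :+ m)) refl m)) ⟩
    (2 + m) * c                   ∎

-- Numbering the trees of a given size

TreeOfSize : ℕ → Set
TreeOfSize s = ∃[ t ] size t ≡ s

private
  code : ∀ {s} ((t , _) : TreeOfSize s) → ∃[ F ] decode {1} {s} F ≡ t ∷ []
  code (t , refl) = encode t (+-identityʳ (size t)) nil

treeIndex : ∀ {s} → TreeOfSize s → Fin (catalan s)
treeIndex {s} t = subst Fin (forestCount≡catalan s) (Inverse.to (Forest↔Fin 1 s) (proj₁ (code t)))

treeIndex-injective : ∀ {s} (t u : TreeOfSize s) → treeIndex t ≡ treeIndex u → proj₁ t ≡ proj₁ u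
treeIndex-injective {s} t u eq = ∷-injectiveˡ (begin
  proj₁ t ∷ []             ≡⟨ proj₂ (code t) ⟨
  decode (proj₁ (code t))  ≡⟨ cong decode (Injection.injective (↔⇒↣ (Forest↔Fin 1 s))
                                (subst-injective (forestCount≡catalan s) eq)) ⟩
  decode (proj₁ (code u))  ≡⟨ proj₂ (code u) ⟩
  proj₁ u ∷ []             ∎)
  where open ≡-Reasoning

treeIndex-surjective : ∀ {s} (y : Fin (catalan s)) → ∃[ t ] treeIndex {s} t ≡ y
treeIndex-surjective {s} y = go (decode F) refl
  where
  open ≡-Reasoning
  count≡ = forestCount≡catalan s
  y′ = subst Fin (sym count≡) y
  F = Inverse.from (Forest↔Fin 1 s) y′

  -- Abstracting `decode F` to a vector of length 1 lets matching expose its only tree.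
  go : ∀ ts → decode F ≡ ts → ∃[ t ] treeIndex {s} t ≡ y
  go (t ∷ []) eq = ts , (begin
    treeIndex ts
      ≡⟨ cong (λ G → subst Fin count≡ (Inverse.to (Forest↔Fin 1 s) G))
           (decode-injective (trans (proj₂ (code ts)) (sym eq))) ⟩
    subst Fin count≡ (Inverse.to (Forest↔Fin 1 s) F)
      ≡⟨ cong (subst Fin count≡) (Inverse.strictlyInverseˡ (Forest↔Fin 1 s) y′) ⟩
    subst Fin count≡ y′
      ≡⟨ subst-subst-sym count≡ ⟩
    y ∎)
    where
    ts : TreeOfSize s
    ts = t , trans (sym (+-identityʳ (size t)))
               (trans (cong totalSize (sym eq)) (totalSize-decode F))

-- Gap labellings and binary trees

-- The nodes of a tree t, in inorder, are the gaps a, …, a + size t − 1 between the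
-- consecutive vertices a, …, a + size t; label a t i m is the topmost gap between i and m
-- (with junk value a outside the tree).
label : ℕ → Tree → ℕ → ℕ → ℕ
label a leaf       i m = a
label a (node l r) i m with m ≤? a + size l | i ≤? a + size l
... | yes _ | _     = label a l i m
... | no  _ | yes _ = a + size l
... | no  _ | no  _ = label (suc (a + size l)) r i m

module _ {a : ℕ} {l r : Tree} {i m : ℕ} where

  label-left : m ≤ a + size l → label a (node l r) i m ≡ label a l i m
  label-left m≤g with m ≤? a + size l
  ... | yes _   = refl
  ... | no  m≰g = contradiction m≤g m≰g

  label-root : i ≤ a + size l → a + size l < m → label a (node l r) i m ≡ a + size l
  label-root i≤g g<m with m ≤? a + size l | i ≤? a + size l
  ... | yes m≤g | _       = contradiction m≤g (<⇒≱ g<m)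
  ... | no  _   | yes _   = refl
  ... | no  _   | no  i≰g = contradiction i≤g i≰g

  label-right : a + size l < i → a + size l < m →
                label a (node l r) i m ≡ label (suc (a + size l)) r i m
  label-right g<i g<m with m ≤? a + size l | i ≤? a + size l
  ... | yes m≤g | _       = contradiction m≤g (<⇒≱ g<m)
  ... | no  _   | yes i≤g = contradiction i≤g (<⇒≱ g<i)
  ... | no  _   | no  _   = refl

-- The right subtree starts at vertex `suc (a + x)`, just past the root gap, and ends where the
-- whole tree ends.
right-end : ∀ a x y → suc (a + x) + y ≡ a + suc (x + y)
right-end a x y = trans (cong suc (+-assoc a x y)) (sym (+-suc a (x + y)))

label-range : ∀ a t {i m} → a ≤ i → i < m → m ≤ a + size t → i ≤ label a t i m × label a t i m < m
label-range a leaf a≤i i<m m≤a+0 =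
  contradiction (≤-trans m≤a+0 (≤-trans (≤-reflexive (+-identityʳ a)) a≤i)) (<⇒≱ i<m)
label-range a (node l r) {i} {m} a≤i i<m m≤b with m ≤? a + size l | i ≤? a + size l
... | yes m≤g | _       = label-range a l a≤i i<m m≤g
... | no  m≰g | yes i≤g = i≤g , ≰⇒> m≰g
... | no  m≰g | no  i≰g = label-range _ r (≰⇒> i≰g) i<m
                            (≤-trans m≤b (≤-reflexive (sym (right-end a (size l) (size r)))))

-- The pair of the first and the last vertex is labelled by the root gap, which fixes the size of
-- the left subtree. The pairs on either side of the root then determine the two subtrees.
label-unique : ∀ a t u → size t ≡ size u →
  (∀ {i m} → a ≤ i → i < m → m ≤ a + size t → label a t i m ≡ label a u i m) → t ≡ u
label-unique a leaf       leaf         _  _    = refl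
label-unique a (node l r) (node l′ r′) eq same = cong₂ node
  (label-unique a l l′ l≡ λ {i} {m} a≤i i<m m≤g → begin
    label a l i m            ≡⟨ label-left {r = r} m≤g ⟨
    label a (node l r) i m   ≡⟨ same a≤i i<m (≤-trans m≤g g≤b) ⟩
    label a (node l′ r′) i m ≡⟨ label-left (subst (λ x → m ≤ a + x) l≡ m≤g) ⟩
    label a l′ i m           ∎)
  (label-unique (suc (a + size l)) r r′ r≡ λ {i} {m} g<i i<m m≤b → begin
    label (suc (a + size l)) r i m    ≡⟨ label-right {l = l} g<i (<-trans g<i i<m) ⟨
    label a (node l r) i m            ≡⟨ same (≤-trans (m≤m+n a _) (<⇒≤ g<i)) i<m
                                           (≤-trans m≤b (≤-reflexive (right-end a (size l) (size r)))) ⟩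
    label a (node l′ r′) i m          ≡⟨ label-right (subst (λ x → a + x < i) l≡ g<i)
                                           (subst (λ x → a + x < m) l≡ (<-trans g<i i<m)) ⟩
    label (suc (a + size l′)) r′ i m  ≡⟨ cong (λ x → label (suc (a + x)) r′ i m) l≡ ⟨
    label (suc (a + size l)) r′ i m   ∎)
  where
  open ≡-Reasoning
  g<b : a + size l < a + size (node l r)
  g<b = +-monoʳ-< a (s≤s (m≤m+n (size l) (size r)))
  g≤b = <⇒≤ g<b
  g′<b : a + size l′ < a + size (node l r)
  g′<b = subst (λ x → a + size l′ < a + x) (sym eq) (+-monoʳ-< a (s≤s (m≤m+n (size l′) (size r′))))
  l≡ : size l ≡ size l′
  l≡ = +-cancelˡ-≡ a _ _ (begin
    a + size l                                     ≡⟨ label-root {r = r} (m≤m+n a (size l)) g<b ⟨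
    label a (node l r) a (a + size (node l r))     ≡⟨ same ≤-refl (≤-<-trans (m≤m+n a _) g<b) ≤-refl ⟩
    label a (node l′ r′) a (a + size (node l r))   ≡⟨ label-root (m≤m+n a (size l′)) g′<b ⟩
    a + size l′                                    ∎)
  r≡ : size r ≡ size r′
  r≡ = +-cancelˡ-≡ (size l) _ _ (trans (suc-injective eq) (cong (_+ size r′) (sym l≡)))

-- The tree of a gap labelling

record GapLabelling (N : ℕ) (f : ℕ → ℕ → ℕ) : Set where
  field
    range : ∀ {i m} → i < m → m ≤ N → i ≤ f i m × f i m < m
    split : ∀ {i j m} → i < j → j < m → m ≤ N → f i m ≡ f i j ⊎ f i m ≡ f j m

module _ {N f} (F : GapLabelling N f) where
  open GapLabelling F

  -- The range bounds f m b ≥ m and f a i < i exclude one alternative of each split.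
  root-dominates : ∀ {a b i m} → b ≤ N → a ≤ i → i ≤ f a b → f a b < m → m ≤ b → f i m ≡ f a b
  root-dominates {a} {b} {i} {m} b≤N a≤i i≤r r<m m≤b = trans fim≡fam fam≡r
    where
    m≤N = ≤-trans m≤b b≤N
    a<m = ≤-<-trans a≤i (≤-<-trans i≤r r<m)
    fam≡r : f a m ≡ f a b
    fam≡r with m≤n⇒m<n∨m≡n m≤b
    ... | inj₂ refl = refl
    ... | inj₁ m<b with split a<m m<b b≤N
    ...   | inj₁ eq = sym eq
    ...   | inj₂ eq = contradiction (proj₁ (range m<b b≤N)) (<⇒≱ (subst (_< m) eq r<m))
    fim≡fam : f i m ≡ f a m
    fim≡fam with m≤n⇒m<n∨m≡n a≤i
    ... | inj₂ refl = refl
    ... | inj₁ a<i with split a<i (≤-<-trans i≤r r<m) m≤N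
    ...   | inj₂ eq = sym eq
    ...   | inj₁ eq = contradiction i≤r
      (<⇒≱ (subst (_< i) (trans (sym eq) fam≡r)
        (proj₂ (range a<i (<⇒≤ (<-≤-trans (≤-<-trans i≤r r<m) m≤N))))))

  tree-of : ∀ k → Acc _<_ k → ∀ a → a + k ≤ N →
    ∃[ t ] size t ≡ k × (∀ {i m} → a ≤ i → i < m → m ≤ a + k → label a t i m ≡ f i m)
  tree-of zero _ a _ = leaf , refl , λ a≤i i<m m≤a+0 →
    contradiction (≤-trans m≤a+0 (≤-trans (≤-reflexive (+-identityʳ a)) a≤i)) (<⇒≱ i<m)
  tree-of (suc k) (acc rec) a b≤N
    with a≤ρ , ρ<b ← range (m<m+n a {suc k} z<s) b≤N
    -- The root gap ρ is the label of the whole interval; `x` gaps lie before it and `y` after it.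
    with x , a+x≡ρ ← m≤n⇒∃[o]m+o≡n a≤ρ
    with y , ρ+y≡b ← m≤n⇒∃[o]m+o≡n ρ<b
    -- The match identifies `k` with `x + y`, so both parts have fewer than `suc k` gaps.
    with refl ← suc-injective (+-cancelˡ-≡ a _ _
           (trans (sym (right-end a x y)) (trans (cong (λ z → suc (z + y)) a+x≡ρ) ρ+y≡b)))
    with l , refl , label-l ← tree-of x (rec (s≤s (m≤m+n x y))) a
           (≤-trans (+-monoʳ-≤ a (m≤n⇒m≤1+n (m≤m+n x y))) b≤N)
    with r , refl , label-r ← tree-of y (rec (s≤s (m≤n+m y x))) (suc (a + x))
           (≤-trans (≤-reflexive (right-end a x y)) b≤N)
    = node l r , refl , correct
    where
    correct : ∀ {i m} → a ≤ i → i < m → m ≤ a + size (node l r) → label a (node l r) i m ≡ f i m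
    correct {i} {m} a≤i i<m m≤b with m ≤? a + size l | i ≤? a + size l
    ... | yes m≤g | _       = label-l a≤i i<m m≤g
    ... | no  m≰g | yes i≤g = trans a+x≡ρ (sym (root-dominates b≤N a≤i
            (subst (i ≤_) a+x≡ρ i≤g) (subst (_< m) a+x≡ρ (≰⇒> m≰g)) m≤b))
    ... | no  m≰g | no  i≰g = label-r (≰⇒> i≰g) i<m
            (≤-trans m≤b (≤-reflexive (sym (right-end a (size l) (size r)))))

-- Closed walks

-- Unlike `vertices`, this includes the final vertex, so that both ends of every edge of the walk
-- are covered.
Within : ∀ {n} {u v : Fin n} → (Fin n → Set) → Walk u v → Set
Within {u = u} Q ε       = Q u
Within {u = u} Q (_ ◅ w) = Q u × Within Q w

module _ {n : ℕ} where

  within-first : ∀ {Q} {u v : Fin n} (w : Walk u v) → Within Q w → Q u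
  within-first ε       q       = q
  within-first (_ ◅ _) (q , _) = q

  within-universal : ∀ {Q : Fin n → Set} → (∀ x → Q x) → ∀ {u v} (w : Walk u v) → Within Q w
  within-universal q {u} ε       = q u
  within-universal q {u} (_ ◅ w) = q u , within-universal q w

  within-map : ∀ {Q R : Fin n → Set} → (∀ {x} → Q x → R x) →
               ∀ {u v} (w : Walk u v) → Within Q w → Within R w
  within-map Q⇒R ε       q        = Q⇒R q
  within-map Q⇒R (_ ◅ w) (q , qs) = Q⇒R q , within-map Q⇒R w qs

  within-forward : ∀ {Q} {u v : Fin n} (w : Walk u v) → Within Q w →
                   ∀ {e} → e ∈ forwardEdges w → Q (Edge.src e) × Q (Edge.tgt e)
  within-forward (fwd _ ◅ w) (q , qs) (here refl) = q , within-first w qs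
  within-forward (fwd _ ◅ w) (_ , qs) (there e∈)  = within-forward w qs e∈
  within-forward (bwd _ ◅ w) (_ , qs) e∈          = within-forward w qs e∈

  within-backward : ∀ {Q} {u v : Fin n} (w : Walk u v) → Within Q w →
                    ∀ {e} → e ∈ backwardEdges w → Q (Edge.src e) × Q (Edge.tgt e)
  within-backward (bwd _ ◅ w) (q , qs) (here refl) = within-first w qs , q
  within-backward (bwd _ ◅ w) (_ , qs) (there e∈)  = within-backward w qs e∈
  within-backward (fwd _ ◅ w) (_ , qs) e∈          = within-backward w qs e∈

  -- Gap g lies between the vertices g and g + 1, whence one weak and one strict inequality.
  Crosses : ℕ → Edge n → Set
  Crosses g e = toℕ (Edge.src e) ≤ g × g < toℕ (Edge.tgt e)

  CrossesUp CrossesDown : ∀ {u v : Fin n} → ℕ → Walk u v → Set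
  CrossesUp   g w = ∃[ e ] e ∈ forwardEdges  w × Crosses g e
  CrossesDown g w = ∃[ e ] e ∈ backwardEdges w × Crosses g e

  up-◅ : ∀ {g} {u v x : Fin n} (s : SymClosure _<ᶠ_ u v) (w : Walk v x) →
         CrossesUp g w → CrossesUp g (s ◅ w)
  up-◅ (fwd _) w (e , e∈ , c) = e , there e∈ , c
  up-◅ (bwd _) w c            = c

  down-◅ : ∀ {g} {u v x : Fin n} (s : SymClosure _<ᶠ_ u v) (w : Walk v x) →
         CrossesDown g w → CrossesDown g (s ◅ w)
  down-◅ (bwd _) w (e , e∈ , c) = e , there e∈ , c
  down-◅ (fwd _) w c            = c

  step-up : ∀ {g} {u v x : Fin n} (s : SymClosure _<ᶠ_ u v) (w : Walk v x) →
            toℕ u ≤ g → g < toℕ v → CrossesUp g (s ◅ w)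
  step-up (fwd _) w u≤g g<v = _ , here refl , u≤g , g<v
  step-up (bwd p) w u≤g g<v = contradiction (≤-trans (<⇒≤ p) u≤g) (<⇒≱ g<v)

  step-down : ∀ {g} {u v x : Fin n} (s : SymClosure _<ᶠ_ u v) (w : Walk v x) →
              g < toℕ u → toℕ v ≤ g → CrossesDown g (s ◅ w)
  step-down (bwd _) w g<u v≤g = _ , here refl , v≤g , g<u
  step-down (fwd p) w g<u v≤g = contradiction (≤-trans (<⇒≤ p) v≤g) (<⇒≱ g<u)

  ascent : ∀ {g} {u v : Fin n} (w : Walk u v) → toℕ u ≤ g → g < toℕ v → CrossesUp g w
  ascent ε u≤g g<u = contradiction u≤g (<⇒≱ g<u)
  ascent {g} (_◅_ {j = x} s w) u≤g g<v with toℕ x ≤? g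
  ... | yes x≤g = up-◅ s w (ascent w x≤g g<v)
  ... | no  x≰g = step-up s w u≤g (≰⇒> x≰g)

  descent : ∀ {g} {u v : Fin n} (w : Walk u v) → g < toℕ u → toℕ v ≤ g → CrossesDown g w
  descent ε g<u u≤g = contradiction u≤g (<⇒≱ g<u)
  descent {g} (_◅_ {j = x} s w) g<u v≤g with toℕ x ≤? g
  ... | yes x≤g = step-down s w g<u x≤g
  ... | no  x≰g = down-◅ s w (descent w (≰⇒> x≰g) v≤g)

  CrossesBothWays : ∀ {u v : Fin n} → ℕ → Walk u v → Set
  CrossesBothWays g w = CrossesUp g w × CrossesDown g w

  -- The first step that leaves the lower side crosses the gap upwards, and the rest of the walk
  -- must come back down to `v`.
  stay-below : ∀ {g Q} {u v : Fin n} (w : Walk u v) → Within Q w → toℕ u ≤ g → toℕ v ≤ g →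
               Within (λ x → Q x × toℕ x ≤ g) w ⊎ CrossesBothWays g w
  stay-below ε q u≤g _ = inj₁ (q , u≤g)
  stay-below {g} (_◅_ {j = x} s w) (q , qs) u≤g v≤g with toℕ x ≤? g
  ... | yes x≤g = ⊎-map ((q , u≤g) ,_) (×-map (up-◅ s w) (down-◅ s w)) (stay-below w qs x≤g v≤g)
  ... | no  x≰g = inj₂ (step-up s w u≤g (≰⇒> x≰g) , down-◅ s w (descent w (≰⇒> x≰g) v≤g))

  stay-above : ∀ {g Q} {u v : Fin n} (w : Walk u v) → Within Q w → g < toℕ u → g < toℕ v →
               Within (λ x → Q x × g < toℕ x) w ⊎ CrossesBothWays g w
  stay-above ε q g<u _ = inj₁ (q , g<u)
  stay-above {g} (_◅_ {j = x} s w) (q , qs) g<u g<v with toℕ x ≤? g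
  ... | yes x≤g = inj₂ (up-◅ s w (ascent w x≤g g<v) , step-down s w g<u x≤g)
  ... | no  x≰g = ⊎-map ((q , g<u) ,_) (×-map (up-◅ s w) (down-◅ s w)) (stay-above w qs (≰⇒> x≰g) g<v)

  Span : ℕ → Tree → Fin n → Set
  Span a t x = a ≤ toℕ x × toℕ x ≤ a + size t

  edgeLabel : ℕ → Tree → Edge n → ℕ
  edgeLabel a t e = label a t (toℕ (Edge.src e)) (toℕ (Edge.tgt e))

  -- Descend to the smallest subtree spanning the walk: there the walk crosses the root gap,
  -- hence, being closed, crosses it in both directions.
  closed-walk-labels : ∀ a t {u v : Fin n} (s : SymClosure _<ᶠ_ u v) (w : Walk v u) →
    Within (Span a t) (s ◅ w) →
    ∃[ e ] ∃[ f ] e ∈ forwardEdges (s ◅ w) × f ∈ backwardEdges (s ◅ w)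
                × edgeLabel a t e ≡ edgeLabel a t f
  -- A leaf spans a single vertex, so the first step `s` is impossible there.
  closed-walk-labels a leaf {u} {v} s w (qu , qs) = contradiction (trans (only-a qu) (sym (only-a qv))) (≢ s)
    where
    qv = within-first w qs
    only-a : ∀ {x} → Span a leaf x → toℕ x ≡ a
    only-a (a≤x , x≤a+0) = ≤-antisym (≤-trans x≤a+0 (≤-reflexive (+-identityʳ a))) a≤x
    ≢ : SymClosure _<ᶠ_ u v → toℕ u ≢ toℕ v
    ≢ (fwd p) = <⇒≢ p
    ≢ (bwd p) = >⇒≢ p
  closed-walk-labels a (node l r) {u} s w qs with toℕ u ≤? a + size l
  ... | yes u≤g with stay-below (s ◅ w) qs u≤g u≤g
  ...   | inj₂ ((e , e∈ , e≤g , g<e) , (f , f∈ , f≤g , g<f)) =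
    e , f , e∈ , f∈ , trans (label-root {r = r} e≤g g<e) (sym (label-root f≤g g<f))
  ...   | inj₁ qs′
    with e , f , e∈ , f∈ , same ← closed-walk-labels a l s w
           (within-map (λ ((a≤x , _) , x≤g) → a≤x , x≤g) (s ◅ w) qs′)
    = e , f , e∈ , f∈ , trans (label-left (proj₂ (proj₂ (within-forward (s ◅ w) qs′ e∈))))
        (trans same (sym (label-left (proj₂ (proj₂ (within-backward (s ◅ w) qs′ f∈))))))
  closed-walk-labels a (node l r) {u} s w qs | no u≰g with stay-above (s ◅ w) qs (≰⇒> u≰g) (≰⇒> u≰g)
  ...   | inj₂ ((e , e∈ , e≤g , g<e) , (f , f∈ , f≤g , g<f)) =
    e , f , e∈ , f∈ , trans (label-root {r = r} e≤g g<e) (sym (label-root f≤g g<f))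
  ...   | inj₁ qs′
    with e , f , e∈ , f∈ , same ← closed-walk-labels (suc (a + size l)) r s w
           (within-map (λ ((_ , x≤b) , g<x) → g<x ,
              ≤-trans x≤b (≤-reflexive (sym (right-end a (size l) (size r))))) (s ◅ w) qs′)
    with (_ , g<e) , (_ , g<e′) ← within-forward (s ◅ w) qs′ e∈
    with (_ , g<f) , (_ , g<f′) ← within-backward (s ◅ w) qs′ f∈
    = e , f , e∈ , f∈ , trans (label-right {l = l} g<e g<e′) (trans same (sym (label-right {l = l} g<f g<f′)))

-- Maximal transitive partitions

-- If i ≠ j had the same image, every value would have a preimage other than i. Choosing such
-- preimages and punching out i would inject `Fin (suc n)` into `Fin n`.
surjective⇒injective : ∀ {n} {f : Fin n → Fin n} → StrictlySurjective _≡_ f → Injective _≡_ _≡_ f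
surjective⇒injective {suc n} {f} surj {i} {j} fi≡fj with i ≟ᶠ j
... | yes i≡j = i≡j
... | no  i≢j = contradiction (injective⇒≤ punched-injective) 1+n≰n
  where
  avoiding-i : ∀ y → ∃[ x ] i ≢ x × f x ≡ y
  avoiding-i y with x , fx≡y ← surj y with i ≟ᶠ x
  ... | no  i≢x  = x , i≢x , fx≡y
  ... | yes refl = j , i≢j , trans (sym fi≡fj) fx≡y

  punched : Fin (suc n) → Fin n
  punched y = punchOut (proj₁ (proj₂ (avoiding-i y)))

  punched-injective : Injective _≡_ _≡_ punched
  punched-injective {x} {y} eq with avoiding-i x | avoiding-i y
  ... | _ , i≢x , fx≡ | _ , i≢y , fy≡ =
    trans (sym fx≡) (trans (cong f (punchOut-injective i≢x i≢y eq)) fy≡)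

edge-cong : ∀ {n} {u u′ v v′ : Fin n} .{p : u <ᶠ v} .{q : u′ <ᶠ v′} →
            u ≡ u′ → v ≡ v′ → edge u v p ≡ edge u′ v′ q
edge-cong refl refl = refl

edgeBetween : ∀ {s i m} → i < m → m ≤ s → Edge (suc s)
edgeBetween i<m m≤s = edge (fromℕ< (<-trans i<m (s≤s m≤s))) (fromℕ< (s≤s m≤s))
  (subst₂ _<_ (sym (toℕ-fromℕ< _)) (sym (toℕ-fromℕ< _)) i<m)

-- The cycle i, j, m has (i , m) as its only backward edge, which must therefore share its block
-- with a forward one.
triangle : ∀ {n k} (P : TransitivePartition n k) {i j m : Fin n} (p : i <ᶠ j) (q : j <ᶠ m) →
           block P (edge i m (<-trans p q)) ≡ block P (edge i j p) ⊎
           block P (edge i m (<-trans p q)) ≡ block P (edge j m q)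
triangle P {i} {j} {m} p q
  with transitive P (fwd p ◅ fwd q ◅ bwd (<-trans p q) ◅ ε)
         (≤-refl , (<⇒≢ᶠ p ∷ <⇒≢ᶠ (<-trans p q) ∷ []) ∷ (<⇒≢ᶠ q ∷ []) ∷ [] ∷ [])
... | _ , _ , here refl         , here refl , eq = inj₁ (sym eq)
... | _ , _ , there (here refl) , here refl , eq = inj₂ (sym eq)

consecutive : ∀ {s} → Fin s → Edge (suc s)
consecutive j = edge (inject₁ j) (suc j) (≤̄⇒inject₁< ≤-refl)

predecessor : ∀ {s} {u v : Fin (suc s)} → u <ᶠ v → ∃[ j ] inject₁ j ≡ u
predecessor {v = v} u<v = fromℕ< u<s , toℕ-injective (trans (toℕ-inject₁ _) (toℕ-fromℕ< u<s))
  where u<s = <-≤-trans u<v (toℕ≤pred[n] v)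

-- From a maximal partition to its tree

module Maximal {s : ℕ} (P : TransitivePartition (suc s) s) where

  ConsecutiveBetween : (u v : Fin (suc s)) → Fin s → Set
  ConsecutiveBetween u v b = ∃[ j ] toℕ u ≤ toℕ j × toℕ j < toℕ v × block P (consecutive j) ≡ b

  -- Induction on a bound `d` for the length of the edge: the triangle u, u + 1, v leads either to
  -- the consecutive edge at u or to the shorter edge (u + 1 , v).
  shares-block-with-consecutive : ∀ d {u v : Fin (suc s)} (p : u <ᶠ v) → toℕ v ∸ toℕ u ≤ d →
    ConsecutiveBetween u v (block P (edge u v p))
  shares-block-with-consecutive zero p v∸u≤0 = contradiction (m∸n≡0⇒m≤n (n≤0⇒n≡0 v∸u≤0)) (<⇒≱ p)
  shares-block-with-consecutive (suc d) {u} {v} p v∸u≤1+d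
    with j , refl ← predecessor p
    with m≤n⇒m<n∨m≡n (subst (_< toℕ v) (toℕ-inject₁ j) p)
  ... | inj₂ 1+j≡v = j , ≤-reflexive (toℕ-inject₁ j) , ≤-reflexive 1+j≡v ,
    cong (block P) (edge-cong refl (toℕ-injective 1+j≡v))
  ... | inj₁ 1+j<v with triangle P (≤̄⇒inject₁< {i = j} {j = j} ≤-refl) 1+j<v
  ...   | inj₁ eq = j , ≤-reflexive (toℕ-inject₁ j) , <⇒≤ 1+j<v , sym eq
  ...   | inj₂ eq
    with i , 1+j≤i , i<v , eq′ ← shares-block-with-consecutive d {suc j} 1+j<v
           (s≤s⁻¹ (≤-trans (≤-reflexive (trans (sym (+-∸-assoc 1 (<⇒≤ 1+j<v)))
             (cong (toℕ v ∸_) (sym (toℕ-inject₁ j))))) v∸u≤1+d))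
    = i , ≤-trans (≤-reflexive (toℕ-inject₁ j)) (<⇒≤ 1+j≤i) , i<v , trans eq′ (sym eq)

  nearby : (e : Edge (suc s)) → ConsecutiveBetween (Edge.src e) (Edge.tgt e) (block P e)
  -- The inequality stored in an edge is irrelevant; deciding it yields a usable proof.
  nearby (edge u v u<v) = shares-block-with-consecutive _ (recompute (_ <? _) u<v) ≤-refl

  -- A name for the block that does not depend on the labels chosen by `block`: by
  -- `consecutive-injective`, each block contains only one consecutive edge.
  gap : Edge (suc s) → Fin s
  gap = proj₁ ∘ nearby

  block-gap : ∀ e → block P (consecutive (gap e)) ≡ block P e
  block-gap e = proj₂ (proj₂ (proj₂ (nearby e)))

  -- This is where maximality enters: the s consecutive edges meet all s blocks, hence each block
  -- once.
  consecutive-injective : Injective _≡_ _≡_ (block P ∘ consecutive)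
  consecutive-injective = surjective⇒injective λ b →
    let e , hit = nonempty P b in gap e , trans (block-gap e) (hit refl)

  gap-cong : ∀ {e f} → block P e ≡ block P f → gap e ≡ gap f
  gap-cong {e} {f} eq = consecutive-injective (trans (block-gap e) (trans eq (sym (block-gap f))))

  gap-injective : ∀ {e f} → gap e ≡ gap f → block P e ≡ block P f
  gap-injective {e} {f} eq = trans (sym (block-gap e)) (trans (cong (block P ∘ consecutive) eq) (block-gap f))

  gap-consecutive : ∀ j → gap (consecutive j) ≡ j
  gap-consecutive j = consecutive-injective (block-gap (consecutive j))

  -- The junk value 0 is taken off the range i < m ≤ s.
  gapℕ : ℕ → ℕ → ℕ
  gapℕ i m with i <? m | m ≤? s
  ... | yes i<m | yes m≤s = toℕ (gap (edgeBetween i<m m≤s))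
  ... | _       | _       = 0

  gapℕ-defined : ∀ {i m} (i<m : i < m) (m≤s : m ≤ s) →
    gapℕ i m ≡ toℕ (gap (edgeBetween i<m m≤s))
  gapℕ-defined {i} {m} i<m m≤s with i <? m | m ≤? s
  ... | yes _  | yes _  = refl
  ... | no i≮m | _      = contradiction i<m i≮m
  ... | yes _  | no m≰s = contradiction m≤s m≰s

  gapℕ-gap : ∀ e → gapℕ (toℕ (Edge.src e)) (toℕ (Edge.tgt e)) ≡ toℕ (gap e)
  gapℕ-gap (edge u v u<v) = trans (gapℕ-defined (recompute (_ <? _) u<v) (toℕ≤pred[n] v))
    (cong (toℕ ∘ gap) (edge-cong (fromℕ<-toℕ u _) (fromℕ<-toℕ v _)))

  -- Matching on the equation turns a number into `toℕ` of a vertex, the form to which `gapℕ-gap`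
  -- applies.
  vertex : ∀ {i} → i ≤ s → ∃[ u ] toℕ {suc s} u ≡ i
  vertex i≤s = fromℕ< (s≤s i≤s) , toℕ-fromℕ< (s≤s i≤s)

  gapℕ-labelling : GapLabelling s gapℕ
  gapℕ-labelling = record { range = range ; split = split }
    where
    range : ∀ {i m} → i < m → m ≤ s → i ≤ gapℕ i m × gapℕ i m < m
    range i<m m≤s
      with u , refl ← vertex (<⇒≤ (<-≤-trans i<m m≤s)) | v , refl ← vertex m≤s
      rewrite gapℕ-gap (edge u v i<m)
      with _ , u≤j , j<v , _ ← nearby (edge u v i<m) = u≤j , j<v

    split : ∀ {i j m} → i < j → j < m → m ≤ s → gapℕ i m ≡ gapℕ i j ⊎ gapℕ i m ≡ gapℕ j m
    split i<j j<m m≤s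
      with u , refl ← vertex (<⇒≤ (<-≤-trans (<-trans i<j j<m) m≤s))
         | x , refl ← vertex (<⇒≤ (<-≤-trans j<m m≤s))
         | v , refl ← vertex m≤s
      rewrite gapℕ-gap (edge u v (<-trans i<j j<m)) | gapℕ-gap (edge u x i<j) | gapℕ-gap (edge x v j<m)
      = ⊎-map (cong toℕ ∘ gap-cong) (cong toℕ ∘ gap-cong) (triangle P i<j j<m)

  tree-exists : ∃[ t ] size t ≡ s ×
    (∀ {i m} → 0 ≤ i → i < m → m ≤ s → label 0 t i m ≡ gapℕ i m)
  tree-exists = tree-of gapℕ-labelling s (<-wellFounded s) 0 ≤-refl

  tree : TreeOfSize s
  tree = proj₁ tree-exists , proj₁ (proj₂ tree-exists)

  tree-label : ∀ e → edgeLabel 0 (proj₁ tree) e ≡ toℕ (gap e)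
  tree-label e@(edge u v u<v) = trans
    (proj₂ (proj₂ tree-exists) z≤n (recompute (_ <? _) u<v) (toℕ≤pred[n] v)) (gapℕ-gap e)

open Maximal using (tree; tree-label; gap)

-- Partitions up to renaming of blocks correspond to trees

edgeLabels-determine : ∀ {s} (t u : TreeOfSize s) →
  (∀ (e : Edge (suc s)) → edgeLabel 0 (proj₁ t) e ≡ edgeLabel 0 (proj₁ u) e) → proj₁ t ≡ proj₁ u
edgeLabels-determine (t , refl) (u , size≡) same = label-unique 0 t u (sym size≡) λ {i} {m} _ i<m m≤s →
  subst₂ (λ x y → label 0 t x y ≡ label 0 u x y) (toℕ-fromℕ< _) (toℕ-fromℕ< _)
    (same (edgeBetween i<m m≤s))

-- In `P` the edge e shares its block with the consecutive edge at `gap P e`. This passes to `Q`,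
-- where a consecutive edge is its own gap, so the gaps agree.
tree-cong : ∀ {s} {P Q : TransitivePartition (suc s) s} → P ≈ Q → proj₁ (tree P) ≡ proj₁ (tree Q)
tree-cong {P = P} {Q} P≈Q = edgeLabels-determine (tree P) (tree Q) λ e → begin
  edgeLabel 0 (proj₁ (tree P)) e          ≡⟨ tree-label P e ⟩
  toℕ (gap P e)                           ≡⟨ cong toℕ (gap-consecutive Q (gap P e)) ⟨
  toℕ (gap Q (consecutive (gap P e)))     ≡⟨ cong toℕ (gap-cong Q (Equivalence.to (P≈Q _ _) (block-gap P e))) ⟩
  toℕ (gap Q e)                           ≡⟨ tree-label Q e ⟨
  edgeLabel 0 (proj₁ (tree Q)) e          ∎
  where
  open ≡-Reasoning
  open Maximal using (gap-consecutive; gap-cong; block-gap)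

-- The tree determines the gaps of all edges, and the blocks are exactly the fibres of `gap`.
tree-injective : ∀ {s} {P Q : TransitivePartition (suc s) s} → proj₁ (tree P) ≡ proj₁ (tree Q) → P ≈ Q
tree-injective {P = P} {Q} eq e f = mk⇔
  (λ same → gap-injective Q (trans (sym (gap≡ e)) (trans (gap-cong P same) (gap≡ f))))
  (λ same → gap-injective P (trans (gap≡ e) (trans (gap-cong Q same) (sym (gap≡ f)))))
  where
  open Maximal using (gap-injective; gap-cong)
  gap≡ : ∀ e → gap P e ≡ gap Q e
  gap≡ e = toℕ-injective (trans (sym (tree-label P e))
             (trans (cong (λ t → edgeLabel 0 t e) eq) (tree-label Q e)))

module _ {s : ℕ} (t : Tree) (size≡s : size t ≡ s) where

  treeBlock-range : (e : Edge (suc s)) → toℕ (Edge.src e) ≤ edgeLabel 0 t e × edgeLabel 0 t e < toℕ (Edge.tgt e)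
  treeBlock-range (edge u v u<v) = label-range 0 t z≤n (recompute (_ <? _) u<v)
    (≤-trans (toℕ≤pred[n] v) (≤-reflexive (sym size≡s)))

  treeBlock-bound : ∀ e → edgeLabel 0 t e < s
  treeBlock-bound e = <-≤-trans (proj₂ (treeBlock-range e)) (toℕ≤pred[n] (Edge.tgt e))

  -- Only one gap lies between consecutive vertices, so the range of the label leaves no choice.
  edgeLabel-consecutive : ∀ j → edgeLabel 0 t (consecutive j) ≡ toℕ j
  edgeLabel-consecutive j = ≤-antisym
    (s≤s⁻¹ (proj₂ (treeBlock-range (consecutive j))))
    (≤-trans (≤-reflexive (sym (toℕ-inject₁ j))) (proj₁ (treeBlock-range (consecutive j))))

  within-all : ∀ {u v : Fin (suc s)} (w : Walk u v) → Within (Span 0 t) w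
  within-all = within-universal λ x → z≤n , ≤-trans (toℕ≤pred[n] x) (≤-reflexive (sym size≡s))

  treePartition : TransitivePartition (suc s) s
  treePartition .block e = fromℕ< (treeBlock-bound e)
  treePartition .nonempty j = consecutive j , λ { refl → toℕ-injective (trans (toℕ-fromℕ< _) (edgeLabel-consecutive j)) }
  treePartition .transitive ε       (() , _)
  treePartition .transitive (s ◅ w) _
    with e , f , e∈ , f∈ , eq ← closed-walk-labels 0 t s w (within-all (s ◅ w))
    = e , f , e∈ , f∈ , fromℕ<-cong _ _ eq _ _

  -- An edge and the consecutive edge at its gap share a block, hence a label in `t`; the label of
  -- the latter is the gap itself.
  tree-treePartition : proj₁ (tree treePartition) ≡ t
  tree-treePartition = edgeLabels-determine (tree treePartition) (t , size≡s) λ e → begin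
    edgeLabel 0 (proj₁ (tree treePartition)) e   ≡⟨ tree-label treePartition e ⟩
    toℕ (gap treePartition e)
      ≡⟨ edgeLabel-consecutive (gap treePartition e) ⟨
    edgeLabel 0 t (consecutive (gap treePartition e))
      ≡⟨ fromℕ<-injective _ _ _ _ (block-gap treePartition e) ⟩
    edgeLabel 0 t e ∎
    where
    open ≡-Reasoning
    open Maximal using (block-gap)

theorem1p19 : ∀ (n : ℕ) → 1 < n →
    HasCardinality (maximalTransitivePartitions n) (catalan (n ∸ 1))
theorem1p19 (suc s) _ = record
  { to        = λ P → treeIndex (tree P)
  ; cong      = λ {P} {Q} → index-cong P Q
  ; bijective = (λ {P} {Q} eq → tree-injective {P = P} {Q} (treeIndex-injective (tree P) (tree Q) eq))
              , surjective
  }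
  where
  -- The index is computed by matching on the size proof, so two such proofs have to be identified.
  treeIndex-cong : ∀ (t u : TreeOfSize s) → proj₁ t ≡ proj₁ u → treeIndex t ≡ treeIndex u
  treeIndex-cong (t , p) (t , q) refl = cong (λ p → treeIndex (t , p)) (≡-irrelevant p q)

  index-cong : ∀ (P Q : TransitivePartition (suc s) s) → P ≈ Q → treeIndex (tree P) ≡ treeIndex (tree Q)
  index-cong P Q P≈Q = treeIndex-cong (tree P) (tree Q) (tree-cong {P = P} {Q} P≈Q)

  surjective : Surjective (_≈_ {suc s} {s}) _≡_ (λ P → treeIndex (tree P))
  surjective y with (t , size≡s) , index≡y ← treeIndex-surjective y =
    Q , λ {P} P≈Q → trans (index-cong P Q P≈Q)
      (trans (treeIndex-cong (tree Q) (t , size≡s) (tree-treePartition t size≡s)) index≡y)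
    where Q = treePartition t size≡s
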